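{- Let $d$ be a positive integer and let $f\colon\mathbb{F}_2^{d+1}\to\mathbb{F}_2$ be the function of algebraic degree $d$ given by $f(x_1,\dotsc,x_{d+1}) = x_1 \oplus x_2 x_3\dotsm x_d (x_{d+1} \oplus 1)$ (for $d=1$ the product $x_2\dotsm x_d$ is empty, i.e. equal to $1$). For $n>d$ let $\iota(n)$ be the number of elements of $\mathbb{F}_2^n$ that are not in the image of the map $F\colon\mathbb{F}_2^n\to\mathbb{F}_2^n$ induced by $f$. Then, for every $n>d$, $$\iota(n)=\begin{cases} d\cdot 2^{\frac{n}{d}-1} & \text{if } d\mid n,\\ 0 & \text{otherwise.}\end{cases}$$
   Context: For a Boolean function $f\colon\mathbb{F}_2^k\to\mathbb{F}_2$ and $n\geq k$, the induced map $F\colon\mathbb{F}_2^n\to\mathbb{F}_2^n$ is $$F(x_1,\dotsc,x_n)=\big(f(x_1,x_2,\dotsc,x_k),f(x_2,x_3,\dotsc,x_{k+1}),\dotsc,f(x_n,x_1,\dotsc,x_{k-1})\big),$$ with indices cyclic modulo $n$. Here $k=d+1$. -}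

module Defs where

open import Data.Bool.Base using (Bool; true; false; _∧_; _xor_)
open import Data.Bool.Properties using () renaming (_≟_ to _≟ᵇ_)
open import Data.Empty using (⊥)
open import Data.Fin.Base using (Fin; toℕ)
open import Data.Fin.Subset.Properties using (anySubset?)
open import Data.List.Base as List using (List; _++_; filter; length)
open import Data.List.Membership.Propositional using (_∈_)
open import Data.List.Membership.Propositional.Properties using (∈-map⁺; ∈-map⁻; ∈-++⁺ˡ; ∈-++⁺ʳ)
open import Data.List.Relation.Unary.All as All using ()
open import Data.List.Relation.Unary.AllPairs as AllPairs using ()
open import Data.List.Relation.Unary.Any using (here)
open import Data.List.Relation.Unary.Unique.Propositional using (Unique)
open import Data.List.Relation.Unary.Unique.Propositional.Properties using (map⁺; ++⁺)
open import Data.Nat.Base using (ℕ; zero; suc; _+_; NonZero)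
open import Data.Nat.DivMod using (_mod_)
open import Data.Product.Base using (∃-syntax; _×_; _,_)
open import Data.Vec.Base using (Vec; []; _∷_; lookup; tabulate; foldr′; init; last)
open import Data.Vec.Properties using (≡-dec; ∷-injectiveʳ)
open import Relation.Binary.PropositionalEquality using (_≡_; refl)
open import Relation.Nullary.Decidable using (Dec; ¬?)

-- The two-element field, with _xor_ as addition and _∧_ as multiplication;
-- see xor-∧-commutativeRing in Data.Bool.Properties.
𝔽₂ : Set
𝔽₂ = Bool

∏ : ∀ {n} → Vec 𝔽₂ n → 𝔽₂
∏ = foldr′ _∧_ true

shift : ∀ {n} → Fin n → ℕ → Fin n
shift {suc n} i j = (toℕ i + j) mod (suc n)

induced : ∀ {k} → (Vec 𝔽₂ k → 𝔽₂) → ∀ {n} → Vec 𝔽₂ n → Vec 𝔽₂ n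
induced f x = tabulate λ i → f (tabulate λ j → lookup x (shift i (toℕ j)))

InImage : ∀ {n} → (Vec 𝔽₂ n → Vec 𝔽₂ n) → Vec 𝔽₂ n → Set
InImage F y = ∃[ x ] F x ≡ y

-- Subset n in Data.Fin.Subset is Vec Bool n, so anySubset? searches all of 𝔽₂ⁿ.
inImage? : ∀ {n} (F : Vec 𝔽₂ n → Vec 𝔽₂ n) (y : Vec 𝔽₂ n) → Dec (InImage F y)
inImage? F y = anySubset? λ x → ≡-dec _≟ᵇ_ (F x) y

vectors : ∀ n → List (Vec 𝔽₂ n)
vectors zero    = List.[ [] ]
vectors (suc n) = List.map (false ∷_) (vectors n) ++ List.map (true ∷_) (vectors n)

-- Every vector occurs in the list exactly once, so the length of a filtered
-- copy of it is the cardinality of the subset filtered for.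
vectors-complete : ∀ {n} (x : Vec 𝔽₂ n) → x ∈ vectors n
vectors-complete []          = here refl
vectors-complete (false ∷ x) = ∈-++⁺ˡ (∈-map⁺ (false ∷_) (vectors-complete x))
vectors-complete {suc n} (true ∷ x) =
  ∈-++⁺ʳ (List.map (false ∷_) (vectors n)) (∈-map⁺ (true ∷_) (vectors-complete x))

vectors-unique : ∀ n → Unique (vectors n)
vectors-unique zero    = All.[] AllPairs.∷ AllPairs.[]
vectors-unique (suc n) =
  ++⁺ (map⁺ ∷-injectiveʳ (vectors-unique n)) (map⁺ ∷-injectiveʳ (vectors-unique n))
      λ (p , q) → disjoint (∈-map⁻ (false ∷_) p) (∈-map⁻ (true ∷_) q)
  where
  disjoint : ∀ {v} → ∃[ x ] (x ∈ vectors n × v ≡ false ∷ x) →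
               ∃[ x ] (x ∈ vectors n × v ≡ true ∷ x) → ⊥
  disjoint (_ , _ , refl) (_ , _ , ())

ι : ∀ {k} → (Vec 𝔽₂ k → 𝔽₂) → ℕ → ℕ
ι f n = length (filter (λ y → ¬? (inImage? (induced f {n}) y)) (vectors n))

-- x₁ ⊕ x₂x₃⋯x_d (x_{d+1} ⊕ 1): with xs = (x₂,…,x_{d+1}), the product runs over
-- init xs, which is empty when d = 1.
f : ∀ d .{{_ : NonZero d}} → Vec 𝔽₂ (suc d) → 𝔽₂
f (suc _) (x₁ ∷ xs) = x₁ xor (∏ (init xs) ∧ (last xs xor true))

{-# OPTIONS --safe #-}

-- Write d = e + 1.  The equation F x = y says that, reading y cyclically from
-- right to left, each x_i is y_i, flipped exactly when the run of ones of x
-- starting at position i + 1 has length e.  With the run length capped at d as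
-- state, y acts on the states {0,…,d} by a map T y, and y lies in the image of
-- F exactly when T y has a fixed point.  A one rotates the states 0,…,e and
-- fixes d; a zero sends e to d and every other state to 0.  Hence T y has no
-- fixed point exactly when d ∣ n, all zeros of y lie in one residue class
-- modulo d, and their number is odd: then T y swaps two states and maps
-- everything else into these two.  If two zeros are in different classes,
-- T y is constant.  Each of the d classes contains n / d positions and so
-- contributes 2^(n/d − 1) vectors y with an odd number of zeros.
module Submission where

open import Defs
open import Data.Bool.Base using (true; false; not; _∧_; _xor_; if_then_else_)
open import Data.Bool.Properties
  using (xor-assoc; xor-same; xor-identityʳ; not-involutive) renaming (_≟_ to _≟ᵇ_)
open import Data.Empty using (⊥)
open import Data.Fin.Base using (Fin; zero; suc; toℕ)
open import Data.Fin.Properties using (toℕ<n; toℕ-fromℕ<; fromℕ<-toℕ; fromℕ<-cong)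
open import Data.List.Base as List using (filter; length)
open import Data.List.Properties using (length-++; filter-++; filter-≐; filter-none)
import Data.List.Relation.Unary.All as ListAll
open import Data.Nat.Base
  using (ℕ; zero; suc; _+_; _*_; _^_; _∸_; _≤_; _<_; _⊓_; NonZero; z≤n; z<s; s≤s; s≤s⁻¹)
open import Data.Nat.DivMod
  using (_/_; _%_; _mod_; m%n<n; m<n⇒m%n≡m; m%n%n≡m%n; n%n≡0; [m+n]%n≡m%n; [m+kn]%n≡m%n; %-distribˡ-+; m*n/n≡m)
open import Data.Nat.Divisibility using (_∣_; divides; divides-refl)
open import Data.Nat.Properties
open import Data.Product.Base using (∃-syntax; _×_; _,_; proj₁; proj₂)
open import Data.Sum.Base using (_⊎_; inj₁; inj₂; [_,_]′)
open import Data.Vec.Base using (Vec; []; _∷_; lookup; tabulate; foldr′; init; last)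
open import Data.Vec.Properties using (lookup∘tabulate; tabulate∘lookup; tabulate-cong)
open import Data.Vec.Relation.Unary.All using (All; []; _∷_; all?)
open import Function.Base using (_∘_)
open import Relation.Binary.Definitions using (tri<; tri≈; tri>)
open import Relation.Binary.PropositionalEquality
open import Relation.Nullary.Decidable using (yes; no; does; ¬?; dec-true; dec-false)
open import Relation.Nullary.Negation using (contradiction)
open import Relation.Nullary.Negation.Core using (¬_)
open import Relation.Unary using (Pred; Decidable)
open import Relation.Unary.Properties using (_∪?_)

-- Counting binary vectors

count : ∀ {n p} {P : Pred (Vec 𝔽₂ n) p} → Decidable P → ℕ
count {n} P? = length (filter P? (vectors n))

length-filter-map : ∀ {a b p} {A : Set a} {B : Set b} {P : Pred B p} (P? : Decidable P)
  (g : A → B) xs → length (filter P? (List.map g xs)) ≡ length (filter (P? ∘ g) xs)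
length-filter-map P? g List.[] = refl
length-filter-map P? g (x List.∷ xs) with does (P? (g x))
... | true  = cong suc (length-filter-map P? g xs)
... | false = length-filter-map P? g xs

length-filter-∪ : ∀ {a p q} {A : Set a} {P : Pred A p} {Q : Pred A q}
  (P? : Decidable P) (Q? : Decidable Q) → (∀ {x} → P x → ¬ Q x) →
  ∀ xs → length (filter (P? ∪? Q?) xs) ≡ length (filter P? xs) + length (filter Q? xs)
length-filter-∪ P? Q? disj List.[] = refl
length-filter-∪ P? Q? disj (x List.∷ xs) with P? x | Q? x
... | yes p | yes q = contradiction q (disj p)
... | yes p | no _  = cong suc (length-filter-∪ P? Q? disj xs)
... | no _  | yes q = trans (cong suc (length-filter-∪ P? Q? disj xs)) (sym (+-suc _ _))
... | no _  | no _  = length-filter-∪ P? Q? disj xs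

count-suc : ∀ {n p} {P : Pred (Vec 𝔽₂ (suc n)) p} (P? : Decidable P) →
  count P? ≡ count (P? ∘ (false ∷_)) + count (P? ∘ (true ∷_))
count-suc {n} P? = begin
  length (filter P? (List.map (false ∷_) vs List.++ List.map (true ∷_) vs))
    ≡⟨ cong length (filter-++ P? (List.map (false ∷_) vs) _) ⟩
  length (filter P? (List.map (false ∷_) vs) List.++ filter P? (List.map (true ∷_) vs))
    ≡⟨ length-++ (filter P? (List.map (false ∷_) vs)) ⟩
  length (filter P? (List.map (false ∷_) vs)) + length (filter P? (List.map (true ∷_) vs))
    ≡⟨ cong₂ _+_ (length-filter-map P? (false ∷_) vs) (length-filter-map P? (true ∷_) vs) ⟩
  count (P? ∘ (false ∷_)) + count (P? ∘ (true ∷_)) ∎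
  where
  open ≡-Reasoning
  vs = vectors n

count-none : ∀ {n p} {P : Pred (Vec 𝔽₂ n) p} (P? : Decidable P) →
  (∀ v → ¬ P v) → count P? ≡ 0
count-none {n} P? none = cong length (filter-none P? (ListAll.universal none (vectors n)))

count-cong : ∀ {n p q} {P : Pred (Vec 𝔽₂ n) p} {Q : Pred (Vec 𝔽₂ n) q}
  (P? : Decidable P) (Q? : Decidable Q) →
  (∀ {v} → P v → Q v) → (∀ {v} → Q v → P v) → count P? ≡ count Q?
count-cong {n} P? Q? to from = cong length (filter-≐ P? Q? (to , from) (vectors n))

-- Cyclic indices

-- By definition, `lookup x (shift i (toℕ j))` is `cyclic x (toℕ i + toℕ j)`.
cyclic : ∀ {n} → Vec 𝔽₂ (suc n) → ℕ → 𝔽₂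
cyclic {n} x m = lookup x (m mod suc n)

cyclic-toℕ : ∀ {n} (x : Vec 𝔽₂ (suc n)) i → cyclic x (toℕ i) ≡ lookup x i
cyclic-toℕ {n} x i = cong (lookup x)
  (trans (fromℕ<-cong _ _ (m<n⇒m%n≡m (toℕ<n i)) (m%n<n (toℕ i) (suc n)) (toℕ<n i))
         (fromℕ<-toℕ i (toℕ<n i)))

cyclic-periodic : ∀ {n} (x : Vec 𝔽₂ (suc n)) m → cyclic x (m + suc n) ≡ cyclic x m
cyclic-periodic {n} x m = cong (lookup x)
  (fromℕ<-cong _ _ ([m+n]%n≡m%n m (suc n)) (m%n<n (m + suc n) (suc n)) (m%n<n m (suc n)))

suc-% : ∀ m n → suc m % suc n ≡ suc (m % suc n) % suc n
suc-% m n = trans (%-distribˡ-+ 1 m N) (sym (trans (%-distribˡ-+ 1 (m % N) N)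
  (cong (λ r → (1 % N + r) % N) (m%n%n≡m%n m N))))
  where N = suc n

-- Transition maps of single letters

module _ (e : ℕ) where

  d : ℕ
  d = suc e

  -- From a bit of `x` and the capped run length at the next position to the capped run length here;
  -- the minimum keeps it at most `d`.
  step : 𝔽₂ → ℕ → ℕ
  step false s = 0
  step true  s = suc (s ⊓ e)

  -- Reads a bit of `y`: the xor recovers the bit of `x`. States are plain naturals; those above `d`
  -- act like `d`, so no bound has to be carried along.
  δ : 𝔽₂ → ℕ → ℕ
  δ b s = step (b xor does (s ≟ e)) s

  T : ∀ {k} → Vec 𝔽₂ k → ℕ → ℕ
  T v s = foldr′ δ s v

  δ-true-≢ : ∀ {s} → s ≢ e → δ true s ≡ suc (s ⊓ e)
  δ-true-≢ {s} s≢e rewrite dec-false (s ≟ e) s≢e = refl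

  δ-true-< : ∀ {s} → s < e → δ true s ≡ suc s
  δ-true-< s<e = trans (δ-true-≢ (<⇒≢ s<e)) (cong suc (m≤n⇒m⊓n≡m (<⇒≤ s<e)))

  δ-true-> : ∀ {s} → e < s → δ true s ≡ d
  δ-true-> e<s = trans (δ-true-≢ (>⇒≢ e<s)) (cong suc (m≥n⇒m⊓n≡n (<⇒≤ e<s)))

  δ-true-e : δ true e ≡ 0
  δ-true-e rewrite dec-true (e ≟ e) refl = refl

  δ-true-d : δ true d ≡ d
  δ-true-d = δ-true-> ≤-refl

  δ-false-e : δ false e ≡ d
  δ-false-e rewrite dec-true (e ≟ e) refl = cong suc (⊓-idem e)

  δ-false-≢ : ∀ {s} → s ≢ e → δ false s ≡ 0
  δ-false-≢ {s} s≢e rewrite dec-false (s ≟ e) s≢e = refl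

  δ-true≡0 : ∀ {s} → δ true s ≡ 0 → s ≡ e
  δ-true≡0 {s} eq with s ≟ e
  ... | yes s≡e = s≡e
  ... | no  s≢e with () ← trans (sym eq) (δ-true-≢ s≢e)

  δ-true≡suc : ∀ {s j} → j < e → δ true s ≡ suc j → s ≡ j
  δ-true≡suc {s} j<e eq with <-cmp s e
  ... | tri< s<e _ _ = suc-injective (trans (sym (δ-true-< s<e)) eq)
  ... | tri> _ _ e<s = contradiction (suc-injective (trans (sym eq) (δ-true-> e<s))) (<⇒≢ j<e)
  ... | tri≈ _ refl _ with () ← trans (sym eq) δ-true-e

  -- Aligned j p v: the zeros of v are at positions congruent to j modulo d, and
  -- their number is odd exactly when p is true.
  Aligned : ∀ {k} → ℕ → 𝔽₂ → Vec 𝔽₂ k → Set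
  Aligned j       p []          = p ≡ false
  Aligned zero    p (true  ∷ v) = Aligned e p v
  Aligned zero    p (false ∷ v) = Aligned e (not p) v
  Aligned (suc j) p (true  ∷ v) = Aligned j p v
  Aligned (suc j) p (false ∷ v) = ⊥

  aligned? : ∀ j p {k} → Decidable (Aligned {k} j p)
  aligned? j       p []          = p ≟ᵇ false
  aligned? zero    p (true  ∷ v) = aligned? e p v
  aligned? zero    p (false ∷ v) = aligned? e (not p) v
  aligned? (suc j) p (true  ∷ v) = aligned? j p v
  aligned? (suc j) p (false ∷ v) = no λ ()

  -- Words without zeros

  AllOnes : ∀ {k} → Vec 𝔽₂ k → Set
  AllOnes = All (_≡ true)

  allOnes? : ∀ {k} → Decidable (AllOnes {k})
  allOnes? = all? (_≟ᵇ true)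

  allOnes-aligned : ∀ {k} {v : Vec 𝔽₂ k} → AllOnes v → ∀ j → Aligned j false v
  allOnes-aligned []            j       = refl
  allOnes-aligned (refl ∷ ones) zero    = allOnes-aligned ones e
  allOnes-aligned (refl ∷ ones) (suc j) = allOnes-aligned ones j

  allOnes-even : ∀ {k} {v : Vec 𝔽₂ k} → AllOnes v → ∀ j {p} → Aligned j p v → p ≡ false
  allOnes-even []            j       al = al
  allOnes-even (refl ∷ ones) zero    al = allOnes-even ones e al
  allOnes-even (refl ∷ ones) (suc j) al = allOnes-even ones j al

  -- A zero would require both countdowns to stand at 0 together, but distinct residues never
  -- coincide.
  allOnes⇐2-aligned : ∀ {k} (v : Vec 𝔽₂ k) i j {p q} → i ≤ e → j ≤ e → i ≢ j →
    Aligned i p v → Aligned j q v → AllOnes v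
  allOnes⇐2-aligned [] i j _ _ _ _ _ = []
  allOnes⇐2-aligned (b ∷ v) zero zero _ _ i≢j _ _ = contradiction refl i≢j
  allOnes⇐2-aligned (true ∷ v) zero (suc j) _ j≤e _ al al′ =
    refl ∷ allOnes⇐2-aligned v e j ≤-refl (<⇒≤ j≤e) (>⇒≢ j≤e) al al′
  allOnes⇐2-aligned (true ∷ v) (suc i) zero i≤e _ _ al al′ =
    refl ∷ allOnes⇐2-aligned v i e (<⇒≤ i≤e) ≤-refl (<⇒≢ i≤e) al al′
  allOnes⇐2-aligned (true ∷ v) (suc i) (suc j) i≤e j≤e i≢j al al′ =
    refl ∷ allOnes⇐2-aligned v i j (<⇒≤ i≤e) (<⇒≤ j≤e) (i≢j ∘ cong suc) al al′

  -- Distance from the end of a word of length k to the next position of the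
  -- class whose first position is j.
  offset : ℕ → ℕ → ℕ
  offset j       zero    = j
  offset zero    (suc k) = offset e k
  offset (suc j) (suc k) = offset j k

  offset≤e : ∀ {j} k → j ≤ e → offset j k ≤ e
  offset≤e          zero    j≤e = j≤e
  offset≤e {zero}   (suc k) j≤e = offset≤e k ≤-refl
  offset≤e {suc j}  (suc k) j≤e = offset≤e k (<⇒≤ j≤e)

  -- The witness `q` is the number of positions of the class inside the word.
  offset-+ : ∀ j k → ∃[ q ] k + offset j k ≡ j + q * d
  offset-+ j       zero    = 0 , sym (+-identityʳ j)
  offset-+ zero    (suc k) = let q , eq = offset-+ e k in suc q , cong suc eq
  offset-+ (suc j) (suc k) = let q , eq = offset-+ j k in q , cong suc eq

  -- Both sides are residues below `d`, and `k + offset j k` is congruent to `j`.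
  offset-∣ : ∀ {j k} → j ≤ e → d ∣ k → offset j k ≡ j
  offset-∣ {j} {k} j≤e (divides-refl m) = begin
    r               ≡⟨ m<n⇒m%n≡m (s≤s (offset≤e k j≤e)) ⟨
    r % d           ≡⟨ [m+kn]%n≡m%n r m d ⟨
    (r + m * d) % d ≡⟨ cong (_% d) (trans (+-comm r k) (proj₂ (offset-+ j k))) ⟩
    (j + q * d) % d ≡⟨ [m+kn]%n≡m%n j q d ⟩
    j % d           ≡⟨ m<n⇒m%n≡m (s≤s j≤e) ⟩
    j ∎
    where
    open ≡-Reasoning
    r = offset j k
    q = proj₁ (offset-+ j k)

  offset≡⇒∣ : ∀ {j k} → offset j k ≡ j → d ∣ k
  offset≡⇒∣ {j} {k} eq = let q , k+r≡j+qd = offset-+ j k in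
    divides q (+-cancelˡ-≡ j k (q * d)
      (trans (+-comm j k) (trans (cong (k +_) (sym eq)) k+r≡j+qd)))

  -- The two states possible at distance j before a position of the class,
  -- when the last zero is in the class.
  level : ℕ → 𝔽₂ → ℕ
  level j q = if q then d else j

  -- Action of letters and aligned words on the two levels

  δ-true-level-< : ∀ {j} q → j < e → δ true (level j q) ≡ level (suc j) q
  δ-true-level-< true  _   = δ-true-d
  δ-true-level-< false j<e = δ-true-< j<e

  δ-true-level-e : ∀ q → δ true (level e q) ≡ level 0 q
  δ-true-level-e true  = δ-true-d
  δ-true-level-e false = δ-true-e

  δ-false-level-e : ∀ q → δ false (level e q) ≡ level 0 (not q)
  δ-false-level-e true  = δ-false-≢ 1+n≢n
  δ-false-level-e false = δ-false-e

  level≢e : ∀ {j} q → j < e → level j q ≢ e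
  level≢e true  _   = 1+n≢n
  level≢e false j<e = <⇒≢ j<e

  -- Ones preserve the level and each zero of the class exchanges the two levels, so only the parity
  -- of the zeros matters.
  T-level : ∀ {k j p} (v : Vec 𝔽₂ k) → j ≤ e → Aligned j p v → ∀ q →
    T v (level (offset j k) q) ≡ level j (q xor p)
  T-level [] _ refl q = cong (level _) (sym (xor-identityʳ q))
  T-level {j = zero} {p} (true ∷ v) _ al q =
    trans (cong (δ true) (T-level v ≤-refl al q)) (δ-true-level-e (q xor p))
  T-level {j = zero} {p} (false ∷ v) _ al q =
    trans (cong (δ false) (T-level v ≤-refl al q))
   (trans (δ-false-level-e (q xor not p)) (cong (level 0) (not-xor-not q p)))
    where
    not-xor-not : ∀ q p → not (q xor not p) ≡ q xor p
    not-xor-not true  p = not-involutive (not p)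
    not-xor-not false p = not-involutive p
  T-level {j = suc j} {p} (true ∷ v) j<e al q =
    trans (cong (δ true) (T-level v (<⇒≤ j<e) al q)) (δ-true-level-< (q xor p) j<e)

  -- Under a one, each state from 0 to `e` has a single predecessor, so tracing `j` back leads only
  -- to `offset j k`.
  T-allOnes-≢ : ∀ {k j s} {v : Vec 𝔽₂ k} → j ≤ e → AllOnes v → s ≢ offset j k → T v s ≢ j
  T-allOnes-≢ j≤e [] s≢ = s≢
  T-allOnes-≢ {j = zero}  j≤e (refl ∷ ones) s≢ = T-allOnes-≢ ≤-refl ones s≢ ∘ δ-true≡0
  T-allOnes-≢ {j = suc j} j<e (refl ∷ ones) s≢ =
    T-allOnes-≢ (<⇒≤ j<e) ones s≢ ∘ δ-true≡suc j<e

  -- Only ones are read before the rightmost zero, and the state there is not `e`, so that zero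
  -- resets it to 0, which is `level 0 false`. The remaining zeros, of parity `not p`, exchange the
  -- levels as before.
  T-collapse : ∀ {k j p s} (v : Vec 𝔽₂ k) → j ≤ e → Aligned j p v → ¬ AllOnes v →
    s ≢ offset j k → T v s ≡ level j (not p)
  T-collapse [] _ _ ¬ones _ = contradiction [] ¬ones
  T-collapse {j = zero} {p} (true ∷ v) _ al ¬ones s≢ =
    trans (cong (δ true) (T-collapse v ≤-refl al (¬ones ∘ (refl ∷_)) s≢)) (δ-true-level-e (not p))
  T-collapse {j = suc j} {p} (true ∷ v) j<e al ¬ones s≢ =
    trans (cong (δ true) (T-collapse v (<⇒≤ j<e) al (¬ones ∘ (refl ∷_)) s≢))
          (δ-true-level-< (not p) j<e)
  T-collapse {j = zero} {p} (false ∷ v) _ al _ s≢ with allOnes? v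
  ... | yes ones = trans (δ-false-≢ (T-allOnes-≢ ≤-refl ones s≢))
                         (cong (level 0) (sym (allOnes-even ones e al)))
  ... | no ¬ones = trans (cong (δ false) (T-collapse v ≤-refl al ¬ones s≢))
                  (trans (δ-false-level-e (not (not p))) (cong (level 0) (not-involutive (not p))))

  aligned⊎constant : ∀ {k} (v : Vec 𝔽₂ k) →
    (∃[ j ] ∃[ p ] (j ≤ e × Aligned j p v)) ⊎ (∃[ c ] ∀ s → T v s ≡ c)
  aligned⊎constant [] = inj₁ (0 , false , z≤n , refl)
  aligned⊎constant (b ∷ v) with aligned⊎constant v
  ... | inj₂ (c , T≡c) = inj₂ (δ b c , λ s → cong (δ b) (T≡c s))
  aligned⊎constant (b ∷ v) | inj₁ (j , p , j≤e , al) with m≤n⇒m<n∨m≡n j≤e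
  aligned⊎constant (true  ∷ v) | inj₁ (j , p , _ , al) | inj₁ j<e = inj₁ (suc j , p , j<e , al)
  aligned⊎constant (true  ∷ v) | inj₁ (_ , p , _ , al) | inj₂ refl = inj₁ (0 , p , z≤n , al)
  aligned⊎constant (false ∷ v) | inj₁ (_ , p , _ , al) | inj₂ refl =
    inj₁ (0 , not p , z≤n , subst (λ p → Aligned e p v) (sym (not-involutive p)) al)
  aligned⊎constant {suc k} (false ∷ v) | inj₁ (j , p , j≤e , al) | inj₁ j<e with allOnes? v
  -- No zero so far: the class is still free and becomes that of the new zero.
  ... | yes ones = inj₁ (0 , true , z≤n , allOnes-aligned ones e)
  -- The new zero clashes with an earlier one: all values of `T v` have the form `level j q`, none
  -- of these is `e`, and so the zero sends them all to 0.
  ... | no ¬ones = inj₂ (0 , λ s → δ-false-≢ (T≢e s))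
    where
    T≢e : ∀ s → T v s ≢ e
    T≢e s with s ≟ offset j k
    ... | yes refl = level≢e p j<e ∘ trans (sym (T-level v j≤e al false))
    ... | no s≢    = level≢e (not p) j<e ∘ trans (sym (T-collapse v j≤e al ¬ones s≢))

  -- Fixed points of the action of a word

  OddAligned : ∀ {k} → Vec 𝔽₂ k → Set
  OddAligned v = ∃[ j ] (j < d × Aligned j true v)

  odd⇒¬allOnes : ∀ {k} (v : Vec 𝔽₂ k) {j} → Aligned j true v → ¬ AllOnes v
  odd⇒¬allOnes _ {j} al ones with () ← allOnes-even ones j al

  -- Divisibility makes `offset j k` equal to `j`; then `j` goes to `d` and every other state goes
  -- to `j`.
  oddAligned⇒noFixedPoint : ∀ {k} (v : Vec 𝔽₂ k) → d ∣ k → OddAligned v → ∀ s → T v s ≢ s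
  oddAligned⇒noFixedPoint {k} v d∣k (j , s≤s j≤e , al) s Ts≡s with s ≟ offset j k
  ... | no s≢ = s≢ (trans (sym Ts≡s) (trans (T-collapse v j≤e al (odd⇒¬allOnes v al) s≢)
                                            (sym (offset-∣ j≤e d∣k))))
  ... | yes refl = contradiction
    (trans (sym (offset-∣ j≤e d∣k)) (trans (sym Ts≡s) (T-level v j≤e al false)))
    (<⇒≢ (s≤s j≤e))

  -- A constant map fixes its value, and an even number of aligned zeros fixes `d`. With an odd
  -- number, every state but `offset j k` goes to `j`, so `j` is fixed unless it equals that offset.
  fixedPoint⊎oddAligned : ∀ {k} (v : Vec 𝔽₂ k) →
    (∃[ s ] T v s ≡ s) ⊎ (d ∣ k × OddAligned v)
  fixedPoint⊎oddAligned {k} v with aligned⊎constant v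
  ... | inj₂ (c , T≡c) = inj₁ (c , T≡c c)
  ... | inj₁ (j , false , j≤e , al) = inj₁ (d , T-level v j≤e al true)
  ... | inj₁ (j , true , j≤e , al) with offset j k ≟ j
  ...   | yes eq = inj₂ (offset≡⇒∣ eq , j , s≤s j≤e , al)
  ...   | no neq = inj₁ (j , T-collapse v j≤e al (odd⇒¬allOnes v al) (neq ∘ sym))

  -- Fixed points of T y and preimages of y

  module _ (X : ℕ → 𝔽₂) (S : ℕ → ℕ) (S-step : ∀ m → S m ≡ step (X m) (S (suc m))) where

    -- The product with its negated last factor detects exactly `m` ones followed by a zero; `m` at
    -- most `e` stays below the cap `d`. Any solution `S` of the recursion is allowed, which serves
    -- both directions: states along `y` and run lengths of `x`.
    runLength-test : ∀ m → m ≤ e → ∀ i (g : Fin (suc m) → 𝔽₂) →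
      (∀ j → g j ≡ X (toℕ j + i)) →
      ∏ (init (tabulate g)) ∧ (last (tabulate g) xor true) ≡ does (S i ≟ m)
    runLength-test zero _ i g g≡ rewrite g≡ zero | S-step i with X i
    ... | true  = refl
    ... | false = refl
    runLength-test (suc m) m<e i g g≡
      with ih ← runLength-test m (<⇒≤ m<e) (suc i) (g ∘ suc)
                  (λ j → trans (g≡ (suc j)) (cong X (sym (+-suc (toℕ j) i))))
      rewrite g≡ zero | S-step i with X i
    ... | false = refl
    ... | true  = trans ih (⊓-test (S (suc i)))
      where
      -- As `m < e`, capping at `e` neither creates nor destroys equality with `m`.
      ⊓-test : ∀ s → does (s ≟ m) ≡ does (s ⊓ e ≟ m)
      ⊓-test s with s ≟ m
      ... | yes refl = trans (dec-true (s ≟ s) refl)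
                             (sym (dec-true (s ⊓ e ≟ s) (m≤n⇒m⊓n≡m (<⇒≤ m<e))))
      ... | no s≢m   = trans (dec-false (s ≟ m) s≢m) (sym (dec-false (s ⊓ e ≟ m) λ eq →
        [ (λ s⊓e≡s → s≢m (trans (sym s⊓e≡s) eq))
        , (λ s⊓e≡e → <⇒≢ m<e (trans (sym eq) s⊓e≡e)) ]′ (⊓-sel s e)))

  F : ∀ {n} → Vec 𝔽₂ n → Vec 𝔽₂ n
  F = induced (f d)

  F-entry : ∀ {n} (x : Vec 𝔽₂ (suc n)) (S : ℕ → ℕ) →
    (∀ m → S m ≡ step (cyclic x m) (S (suc m))) →
    ∀ i → lookup (F x) i ≡ lookup x i xor does (S (suc (toℕ i)) ≟ e)
  F-entry {n} x S S-step i = trans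
    (lookup∘tabulate (λ i → f d (tabulate λ (j : Fin (suc d)) → lookup x (shift i (toℕ j)))) i)
    (cong₂ _xor_
      (trans (cong (cyclic x) (+-identityʳ (toℕ i))) (cyclic-toℕ x i))
      (runLength-test (cyclic x) S S-step e ≤-refl (suc (toℕ i)) _ λ j →
        cong (cyclic x) (trans (+-suc (toℕ i) (toℕ j))
          (trans (cong suc (+-comm (toℕ i) (toℕ j))) (sym (+-suc (toℕ j) (toℕ i)))))))

  xor-cancelʳ : ∀ a b → (a xor b) xor b ≡ a
  xor-cancelʳ a b = trans (xor-assoc a b b) (trans (cong (a xor_) (xor-same b)) (xor-identityʳ a))

  -- Index `k`, just past the last letter, gives the starting state `s`.
  stateAt : ∀ {k} → Vec 𝔽₂ k → ℕ → ℕ → ℕ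
  stateAt []      s i       = s
  stateAt (b ∷ v) s zero    = T (b ∷ v) s
  stateAt (b ∷ v) s (suc i) = stateAt v s i

  stateAt-0 : ∀ {k} (v : Vec 𝔽₂ k) s → stateAt v s 0 ≡ T v s
  stateAt-0 []      s = refl
  stateAt-0 (b ∷ v) s = refl

  stateAt-end : ∀ {k} (v : Vec 𝔽₂ k) s → stateAt v s k ≡ s
  stateAt-end []      s = refl
  stateAt-end (b ∷ v) s = stateAt-end v s

  stateAt-δ : ∀ {k} (v : Vec 𝔽₂ k) s i →
    stateAt v s (toℕ i) ≡ δ (lookup v i) (stateAt v s (suc (toℕ i)))
  stateAt-δ (b ∷ v) s zero    = cong (δ b) (sym (stateAt-0 v s))
  stateAt-δ (b ∷ v) s (suc i) = stateAt-δ v s i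

  fixedPoint⇒inImage : ∀ {n} (y : Vec 𝔽₂ (suc n)) s → T y s ≡ s → InImage F y
  fixedPoint⇒inImage {n} y s Ts≡s = x , (begin
    F x                    ≡⟨ tabulate∘lookup (F x) ⟨
    tabulate (lookup (F x)) ≡⟨ tabulate-cong entry ⟩
    tabulate (lookup y)    ≡⟨ tabulate∘lookup y ⟩
    y ∎)
    where
    open ≡-Reasoning
    N = suc n
    g = stateAt y s

    active : Fin N → 𝔽₂
    active i = does (g (suc (toℕ i)) ≟ e)

    preimage : Fin N → 𝔽₂
    preimage i = lookup y i xor active i

    x = tabulate preimage

    S : ℕ → ℕ
    S m = g (m % N)

    g-% : ∀ {m} → m ≤ N → g (m % N) ≡ g m
    g-% m≤N with m≤n⇒m<n∨m≡n m≤N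
    ... | inj₁ m<N  = cong g (m<n⇒m%n≡m m<N)
    -- Index `N` wraps around to 0; the states agree there because `s` is a fixed point.
    ... | inj₂ refl = trans (cong g (n%n≡0 N))
      (trans (stateAt-0 y s) (trans Ts≡s (sym (stateAt-end y s))))

    S-suc : ∀ m → S (suc m) ≡ g (suc (m % N))
    S-suc m = trans (cong g (suc-% m n)) (g-% (m%n<n m N))

    S-step : ∀ m → S m ≡ step (cyclic x m) (S (suc m))
    S-step m = begin
      g (m % N)   ≡⟨ cong g (toℕ-fromℕ< (m%n<n m N)) ⟨
      g (toℕ r)   ≡⟨ stateAt-δ y s r ⟩
      step (lookup y r xor active r) (g (suc (toℕ r)))
        ≡⟨ cong₂ step (sym (lookup∘tabulate preimage r))
                      (trans (cong (g ∘ suc) (toℕ-fromℕ< (m%n<n m N))) (sym (S-suc m))) ⟩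
      step (cyclic x m) (S (suc m)) ∎
      where r = m mod N

    entry : ∀ i → lookup (F x) i ≡ lookup y i
    entry i = begin
      lookup (F x) i                                   ≡⟨ F-entry x S S-step i ⟩
      lookup x i xor does (S (suc (toℕ i)) ≟ e)
        ≡⟨ cong₂ _xor_ (lookup∘tabulate preimage i) (cong (λ t → does (t ≟ e)) (g-% (toℕ<n i))) ⟩
      (lookup y i xor active i) xor active i           ≡⟨ xor-cancelʳ (lookup y i) (active i) ⟩
      lookup y i ∎

  -- The cap doubles as fuel, since a cyclic sequence of ones has runs without end.
  runLength : ℕ → (ℕ → 𝔽₂) → ℕ → ℕ
  runLength zero    X i = 0
  runLength (suc c) X i = if X i then suc (runLength c X (suc i)) else 0

  runLength-⊓ : ∀ c X i → runLength c X i ≡ runLength (suc c) X i ⊓ c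
  runLength-⊓ zero    X i = sym (⊓-zeroʳ _)
  runLength-⊓ (suc c) X i with X i
  ... | true  = cong suc (runLength-⊓ c X (suc i))
  ... | false = refl

  runLength-step : ∀ X i → runLength d X i ≡ step (X i) (runLength d X (suc i))
  runLength-step X i with X i
  ... | true  = cong suc (runLength-⊓ e X (suc i))
  ... | false = refl

  runLength-periodic : ∀ {X N} → (∀ m → X (m + N) ≡ X m) →
    ∀ c i → runLength c X (i + N) ≡ runLength c X i
  runLength-periodic per zero    i = refl
  runLength-periodic per (suc c) i =
    cong₂ (λ b r → if b then suc r else 0) (per i) (runLength-periodic per c (suc i))

  T-trace : ∀ {k} (v : Vec 𝔽₂ k) (S : ℕ → ℕ) →
    (∀ i → S (toℕ i) ≡ δ (lookup v i) (S (suc (toℕ i)))) → T v (S k) ≡ S 0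
  T-trace []      S S-δ = refl
  T-trace (b ∷ v) S S-δ =
    trans (cong (δ b) (T-trace v (S ∘ suc) (S-δ ∘ suc))) (sym (S-δ zero))

  -- The capped run lengths of `x` obey the `δ` recursion for `F x`, since a flip applied twice
  -- cancels; their periodicity closes the trace.
  inImage⇒fixedPoint : ∀ {n} (y : Vec 𝔽₂ (suc n)) → InImage F y → ∃[ s ] T y s ≡ s
  inImage⇒fixedPoint {n} y (x , refl) =
    S 0 , trans (cong (T y) (sym (runLength-periodic (cyclic-periodic x) d 0))) (T-trace y S S-δ)
    where
    open ≡-Reasoning

    S : ℕ → ℕ
    S = runLength d (cyclic x)

    S-δ : ∀ i → S (toℕ i) ≡ δ (lookup (F x) i) (S (suc (toℕ i)))
    S-δ i = trans (runLength-step (cyclic x) (toℕ i)) (cong (λ b → step b t) (begin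
      cyclic x (toℕ i)                         ≡⟨ cyclic-toℕ x i ⟩
      lookup x i                               ≡⟨ xor-cancelʳ (lookup x i) (does (t ≟ e)) ⟨
      (lookup x i xor does (t ≟ e)) xor does (t ≟ e)
        ≡⟨ cong (_xor does (t ≟ e)) (F-entry x S (runLength-step (cyclic x)) i) ⟨
      lookup (F x) i xor does (t ≟ e) ∎))
      where t = S (suc (toℕ i))

  -- The number of odd aligned vectors

  #aligned : ℕ → 𝔽₂ → ℕ → ℕ
  #aligned j p k = count {k} (aligned? j p)

  #aligned± : ℕ → ℕ → ℕ
  #aligned± j k = #aligned j false k + #aligned j true k

  #aligned-suc : ∀ j p k → #aligned (suc j) p (suc k) ≡ #aligned j p k
  #aligned-suc j p k = trans (count-suc {k} (aligned? (suc j) p))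
    (cong (_+ #aligned j p k) (count-none {k} (λ v → aligned? (suc j) p (false ∷ v)) λ _ ()))

  -- Position 0 is in the class, so its letter can correct the parity of any aligned rest.
  #aligned-zero : ∀ p k → #aligned 0 p (suc k) ≡ #aligned± e k
  #aligned-zero true  k = count-suc {k} (aligned? 0 true)
  #aligned-zero false k = trans (count-suc {k} (aligned? 0 false)) (+-comm (#aligned e true k) _)

  #aligned-+ : ∀ j p k → #aligned j p (j + suc k) ≡ #aligned± e k
  #aligned-+ zero    p k = #aligned-zero p k
  #aligned-+ (suc j) p k = trans (#aligned-suc j p (j + suc k)) (#aligned-+ j p k)

  -- No position of the class fits into the word, which leaves only the word of ones.
  #aligned±-short : ∀ {j k} → k ≤ j → #aligned± j k ≡ 1
  #aligned±-short {j} {zero}  _          = refl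
  #aligned±-short {suc j} {suc k} (s≤s k≤j) =
    trans (cong₂ _+_ (#aligned-suc j false k) (#aligned-suc j true k)) (#aligned±-short k≤j)

  -- Reading up to and including the first class position, `e`, takes `d` letters and doubles the
  -- count; a rest of `a` letters holds no such position.
  #aligned±-* : ∀ {a} q → a ≤ e → #aligned± e (a + q * d) ≡ 2 ^ q
  #aligned±-* {a} zero    a≤e = #aligned±-short (≤-trans (≤-reflexive (+-identityʳ a)) a≤e)
  #aligned±-* {a} (suc q) a≤e = begin
    #aligned± e (a + (d + q * d))       ≡⟨ cong (#aligned± e) a+d+qd ⟩
    #aligned± e (e + suc (a + q * d))   ≡⟨ cong₂ _+_ (half false) (half true) ⟩
    2 ^ q + 2 ^ q                       ≡⟨ cong (2 ^ q +_) (+-identityʳ (2 ^ q)) ⟨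
    2 ^ suc q ∎
    where
    open ≡-Reasoning
    half : ∀ p → #aligned e p (e + suc (a + q * d)) ≡ 2 ^ q
    half p = trans (#aligned-+ e p (a + q * d)) (#aligned±-* q a≤e)

    a+d+qd : a + (d + q * d) ≡ e + suc (a + q * d)
    a+d+qd = trans (sym (+-assoc a d (q * d)))
      (trans (cong (_+ q * d) (+-comm a d))
      (trans (cong suc (+-assoc e a (q * d))) (sym (+-suc e (a + q * d)))))

  -- The word holds `suc q` positions of the class; the parity determines the letter at the first of
  -- them, and `q` free ones remain.
  #aligned-* : ∀ {j} p q → j ≤ e → #aligned j p (suc q * d) ≡ 2 ^ q
  #aligned-* {j} p q j≤e = begin
    #aligned j p (d + q * d)                 ≡⟨ cong (#aligned j p) d+qd ⟩
    #aligned j p (j + suc (e ∸ j + q * d))   ≡⟨ #aligned-+ j p (e ∸ j + q * d) ⟩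
    #aligned± e (e ∸ j + q * d)              ≡⟨ #aligned±-* q (m∸n≤m e j) ⟩
    2 ^ q ∎
    where
    open ≡-Reasoning
    d+qd : d + q * d ≡ j + suc (e ∸ j + q * d)
    d+qd = trans (cong (λ t → suc (t + q * d)) (sym (m+[n∸m]≡n j≤e)))
      (trans (cong suc (+-assoc j (e ∸ j) (q * d))) (sym (+-suc j (e ∸ j + q * d))))

  -- At `m = d` this is `OddAligned` by definition; the variable bound allows induction over the
  -- classes.
  OddAlignedBelow : ∀ {k} → ℕ → Vec 𝔽₂ k → Set
  OddAlignedBelow m v = ∃[ j ] (j < m × Aligned j true v)

  oddAlignedBelow? : ∀ m {k} → Decidable (OddAlignedBelow {k} m)
  oddAlignedBelow? m v = anyUpTo? (λ j → aligned? j true v) m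

  -- A word aligned to two classes has no zeros, hence even parity, so the classes contribute
  -- disjoint sets.
  #oddAlignedBelow : ∀ {m} q → m ≤ d →
    count {suc q * d} (oddAlignedBelow? m) ≡ m * 2 ^ q
  #oddAlignedBelow {zero}  q _ = count-none {suc q * d} (oddAlignedBelow? 0) λ { _ (_ , () , _) }
  #oddAlignedBelow {suc m} q m<d = begin
    count {k} (oddAlignedBelow? (suc m))
      ≡⟨ count-cong {k} (oddAlignedBelow? (suc m)) (aligned? m true ∪? oddAlignedBelow? m)
           (λ {v} → split {v}) (λ {v} → merge {v}) ⟩
    count {k} (aligned? m true ∪? oddAlignedBelow? m)
      ≡⟨ length-filter-∪ (aligned? m true) (oddAlignedBelow? m) (λ {v} → disjoint {v}) (vectors k) ⟩
    #aligned m true k + count {k} (oddAlignedBelow? m)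
      ≡⟨ cong₂ _+_ (#aligned-* true q (s≤s⁻¹ m<d)) (#oddAlignedBelow q (<⇒≤ m<d)) ⟩
    suc m * 2 ^ q ∎
    where
    open ≡-Reasoning
    k = suc q * d

    split : ∀ {v : Vec 𝔽₂ k} → OddAlignedBelow (suc m) v → Aligned m true v ⊎ OddAlignedBelow m v
    split (j , j<1+m , al) with m<1+n⇒m<n∨m≡n j<1+m
    ... | inj₁ j<m  = inj₂ (j , j<m , al)
    ... | inj₂ refl = inj₁ al

    merge : ∀ {v : Vec 𝔽₂ k} → Aligned m true v ⊎ OddAlignedBelow m v → OddAlignedBelow (suc m) v
    merge (inj₁ al)             = m , ≤-refl , al
    merge (inj₂ (j , j<m , al)) = j , m≤n⇒m≤1+n j<m , al

    disjoint : ∀ {v : Vec 𝔽₂ k} → Aligned m true v → ¬ OddAlignedBelow m v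
    disjoint {v} al (j , j<m , al′) = odd⇒¬allOnes v al
      (allOnes⇐2-aligned v m j (s≤s⁻¹ m<d) (s≤s⁻¹ (<-trans j<m m<d)) (>⇒≢ j<m) al al′)

  -- The value of `ι` in the two cases

  ι-∣ : ∀ {n} → 0 < n → d ∣ n → ι (f d) n ≡ d * 2 ^ (n / d ∸ 1)
  ι-∣ _ (divides-refl (suc q)) = trans
    (count-cong {suc q * d} (λ y → ¬? (inImage? F y)) (oddAlignedBelow? d) to from)
    (trans (#oddAlignedBelow q ≤-refl) (cong (λ t → d * 2 ^ (t ∸ 1)) (sym (m*n/n≡m (suc q) d))))
    where
    to : ∀ {y : Vec 𝔽₂ (suc q * d)} → ¬ InImage F y → OddAligned y
    to {y} y∉ with fixedPoint⊎oddAligned y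
    ... | inj₁ (s , eq)   = contradiction (fixedPoint⇒inImage y s eq) y∉
    ... | inj₂ (_ , odd) = odd

    from : ∀ {y : Vec 𝔽₂ (suc q * d)} → OddAligned y → ¬ InImage F y
    from {y} odd y∈ = let s , eq = inImage⇒fixedPoint y y∈ in
      oddAligned⇒noFixedPoint y (divides-refl (suc q)) odd s eq

  ι-∤ : ∀ {n} → ¬ (d ∣ suc n) → ι (f d) (suc n) ≡ 0
  ι-∤ {n} d∤n = count-none {suc n} (λ y → ¬? (inImage? F y)) λ y y∉ →
    [ (λ (s , eq) → y∉ (fixedPoint⇒inImage y s eq)) , d∤n ∘ proj₁ ]′ (fixedPoint⊎oddAligned y)

proposition5p1 : (d : ℕ) .{{_ : NonZero d}} (n : ℕ) → d < n →
    (d ∣ n → ι (f d) n ≡ d * 2 ^ (n / d ∸ 1)) × (¬ (d ∣ n) → ι (f d) n ≡ 0)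
proposition5p1 (suc e) (suc n) d<n = ι-∣ e z<s , ι-∤ e
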